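{- For each $n>0$, the spread $\mathcal{T}_n$ is almost-enumerable.
   Context: Intuitionistic mathematics (constructive reading of logical constants; Markov's Principle not assumed). $\mathcal{N}=\omega^\omega$; finite sequences of naturals are coded bijectively by naturals; $\overline{\alpha}k=\langle\alpha(0),\dots,\alpha(k-1)\rangle$. $J:\omega\times\omega\to\omega$ is a fixed pairing bijection and $\delta^n(m):=\delta(J(n,m))$. For each $n$, $\mathcal{T}_n:=\{\alpha\in\mathcal{N}\mid\forall i[\alpha(i)\le\alpha(i+1)<n]\}$ (a spread). A spread $\mathcal{F}$ is almost-enumerable iff either $\mathcal{F}=\emptyset$ or there is $\delta\in\mathcal{N}$ with $\forall n[\delta^n\in\mathcal{F}]$ and $\forall\alpha\in\mathcal{F}\,\forall\varepsilon\in\mathcal{N}\,\exists n[\overline{\alpha}\varepsilon(n)=\overline{\delta^n}\varepsilon(n)]$. -}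

module Defs where

open import Data.List using (List; []; _∷_; _∷ʳ_; applyUpTo)
open import Data.List.Relation.Unary.All as All using (All; []; _∷_)
import Data.List.Relation.Unary.All.Properties as Allₚ
open import Data.List.Relation.Unary.Linked as Linked using (Linked; []; [-]; _∷_)
import Data.List.Relation.Unary.Linked.Properties as Linkedₚ
open import Data.Nat using (ℕ; zero; suc; _≤_; _<_; _≤?_; _<?_; z<s; s≤s⁻¹)
open import Data.Nat.Properties using (≤-refl; ≤-<-trans)
open import Data.Product using (∃-syntax; _×_; _,_; proj₁; proj₂)
open import Data.Sum using (_⊎_)
open import Function using (_∘_)
open import Function.Bundles using (_⇔_; _⤖_; mk⇔; module Bijection)
open import Level using (0ℓ)
open import Relation.Binary.PropositionalEquality using (_≡_)
open import Relation.Nullary.Decidable using (_×-dec_)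
open import Relation.Unary using (Pred; Decidable; Empty; _∈_)

𝒩 : Set
𝒩 = ℕ → ℕ

-- The initial segment ᾱk = ⟨α(0), …, α(k-1)⟩.  Finite sequences are elements
-- of List ℕ rather than their numerical codes; as the coding is bijective,
-- equality of codes is equality of lists.
infixl 8 _↾_
_↾_ : 𝒩 → ℕ → List ℕ
α ↾ k = applyUpTo α k

-- A spread is given by a decidable set of admissible finite sequences, a
-- finite sequence being admissible iff it has an admissible one-step
-- extension.  The empty sequence need not be admissible, so ∅ is a spread.
record IsSpread (F : Pred 𝒩 0ℓ) : Set₁ where
  field
    Admissible  : Pred (List ℕ) 0ℓ
    admissible? : Decidable Admissible
    extension   : ∀ s → Admissible s ⇔ (∃[ m ] Admissible (s ∷ʳ m))
    membership  : ∀ α → α ∈ F ⇔ (∀ k → Admissible (α ↾ k))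

record Spread : Set₁ where
  constructor mkSpread
  field
    Member   : Pred 𝒩 0ℓ
    isSpread : IsSpread Member

open Spread public using (Member)

-- δⁿ(m) = δ(J(n,m))
row : (ℕ × ℕ) ⤖ ℕ → 𝒩 → ℕ → 𝒩
row J δ n m = δ (Bijection.to J (n , m))

AlmostEnumerable : (ℕ × ℕ) ⤖ ℕ → Spread → Set
AlmostEnumerable J 𝓕 =
  Empty (Member 𝓕)
  ⊎ (∃[ δ ] (∀ n → row J δ n ∈ Member 𝓕)
          × (∀ α → α ∈ Member 𝓕 → ∀ (ε : 𝒩) →
               ∃[ n ] α ↾ ε n ≡ row J δ n ↾ ε n))

InT : ℕ → Pred 𝒩 0ℓ
InT n α = ∀ i → α i ≤ α (suc i) × α (suc i) < n

-- The conjunct 0 < n excludes the empty sequence when n = 0, where it has no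
-- admissible extension.
AdmissibleT : ℕ → Pred (List ℕ) 0ℓ
AdmissibleT n s = 0 < n × All (_< n) s × Linked _≤_ s

private
  linked-∷ʳ⁺ : ∀ {m s} → All (_≤ m) s → Linked _≤_ s → Linked _≤_ (s ∷ʳ m)
  linked-∷ʳ⁺ []        []        = [-]
  linked-∷ʳ⁺ (p ∷ [])  [-]       = p ∷ [-]
  linked-∷ʳ⁺ (_ ∷ ps)  (r ∷ rs)  = r ∷ linked-∷ʳ⁺ ps rs

  linked-∷ʳ⁻ : ∀ {m} s → Linked _≤_ (s ∷ʳ m) → Linked _≤_ s
  linked-∷ʳ⁻ []           _        = []
  linked-∷ʳ⁻ (_ ∷ [])     _        = [-]
  linked-∷ʳ⁻ (_ ∷ y ∷ s)  (r ∷ rs) = r ∷ linked-∷ʳ⁻ (y ∷ s) rs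

  linked-↾⁻ : ∀ (α : 𝒩) i → Linked _≤_ (α ↾ suc (suc i)) → α i ≤ α (suc i)
  linked-↾⁻ α zero    (r ∷ _)  = r
  linked-↾⁻ α (suc i) (_ ∷ rs) = linked-↾⁻ (α ∘ suc) i rs

  extend : ∀ n s → AdmissibleT n s → ∃[ m ] AdmissibleT n (s ∷ʳ m)
  extend (suc n) s (0<n , bd , mono) =
    n , 0<n , Allₚ.∷ʳ⁺ bd ≤-refl , linked-∷ʳ⁺ (All.map s≤s⁻¹ bd) mono

  restrict : ∀ n s → ∃[ m ] AdmissibleT n (s ∷ʳ m) → AdmissibleT n s
  restrict n s (m , 0<n , bd , mono) =
    0<n , proj₁ (Allₚ.∷ʳ⁻ bd) , linked-∷ʳ⁻ s mono

  bounded : ∀ {n} α → InT n α → ∀ i → α i < n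
  bounded α p i = ≤-<-trans (proj₁ (p i)) (proj₂ (p i))

  0<bound : ∀ {n a} → a < n → 0 < n
  0<bound {suc _} _ = z<s

  isSpreadT : ∀ n → IsSpread (InT n)
  isSpreadT n = record
    { Admissible  = AdmissibleT n
    ; admissible? = λ s → (0 <? n) ×-dec (All.all? (_<? n) s ×-dec Linked.linked? _≤?_ s)
    ; extension   = λ s → mk⇔ (extend n s) (restrict n s)
    ; membership  = λ α → mk⇔
        (λ p k → 0<bound (bounded α p 0)
               , Allₚ.applyUpTo⁺₂ α k (bounded α p)
               , Linkedₚ.applyUpTo⁺₂ α k (proj₁ ∘ p))
        (λ q i → linked-↾⁻ α i (proj₂ (proj₂ (q (suc (suc i)))))
               , Allₚ.applyUpTo⁻ α (suc (suc i)) (proj₁ (proj₂ (q (suc (suc i))))) ≤-refl)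
    }

𝒯 : ℕ → Spread
𝒯 n = mkSpread (InT n) (isSpreadT n)

{-# OPTIONS --safe #-}

-- Classically, every α ∈ 𝒯 (n+2) is either 0^ω or 0^k followed by 1 + β with β ∈ 𝒯 (n+1), so
-- an enumeration for 𝒯 (n+2) consists of 0^ω together with all 0^k ⌢ (1 + βᵐ),
-- where βᵐ runs through an enumeration for 𝒯 (n+1).  Which case α falls under
-- is undecidable, but given ε one only compares α with 0^ω up to ε(e), where e is
-- an index of 0^ω: either they agree so far, and e is as wanted, or a first
-- nonzero value of α is found, and the induction hypothesis applies to the rest.
module Submission where

open import Defs
open import Data.List using (_∷_)
open import Data.Nat using (ℕ; zero; suc; pred; _+_; _≤_; _<_; _>_; z≤n; z<s; s≤s; s<s; s<s⁻¹; NonZero; >-nonZero; >-nonZero⁻¹; ≢-nonZero)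
open import Data.Nat.Properties using (_≟_; +-identityʳ; +-suc; <-≤-trans; ≤-<-trans; m<n⇒m<1+n; m<1+n⇒m<n∨m≡n; n<1⇒n≡0; pred-mono-≤; suc-pred)
open import Data.Product using (_×_; _,_; proj₁; proj₂; ∃-syntax)
open import Data.Sum using (_⊎_; inj₁; inj₂)
open import Function using (_∘_; const)
open import Function.Bundles using (_⤖_; module Inverse)
open import Function.Properties.Bijection using (⤖⇒↔)
open import Relation.Binary.PropositionalEquality using (_≡_; refl; sym; trans; cong; cong₂; subst; subst₂)
open import Relation.Nullary using (yes; no)
open import Relation.Unary using (_∈_)

AgreeBelow : ℕ → 𝒩 → 𝒩 → Set
AgreeBelow k α β = ∀ i → i < k → α i ≡ β i

↾-cong : ∀ k {α β} → AgreeBelow k α β → α ↾ k ≡ β ↾ k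
↾-cong zero    _     = refl
↾-cong (suc k) agree = cong₂ _∷_ (agree 0 z<s) (↾-cong k (λ i i<k → agree (suc i) (s<s i<k)))

-- Only the values below `k` are inspected, so decidable equality on `ℕ` settles the case without
-- excluded middle or Markov's Principle.
zeros-or-first-nonzero : ∀ α k →
  AgreeBelow k α (const 0) ⊎ (∃[ m ] AgreeBelow m α (const 0) × NonZero (α m))
zeros-or-first-nonzero α zero = inj₁ λ _ ()
zeros-or-first-nonzero α (suc k) with zeros-or-first-nonzero α k
... | inj₂ found = inj₂ found
... | inj₁ zeros with α k ≟ 0
...   | no  αk≢0 = inj₂ (k , zeros , ≢-nonZero αk≢0)
...   | yes αk≡0 = inj₁ extended
  where
  extended : AgreeBelow (suc k) α (const 0)
  extended i i<1+k with m<1+n⇒m<n∨m≡n i<1+k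
  ... | inj₁ i<k  = zeros i i<k
  ... | inj₂ refl = αk≡0

zerosThenSuc : ℕ → 𝒩 → 𝒩
zerosThenSuc zero    β i       = suc (β i)
zerosThenSuc (suc k) β zero    = 0
zerosThenSuc (suc k) β (suc i) = zerosThenSuc k β i

zerosThenSuc-InT : ∀ {n} k {β} → β ∈ InT n → zerosThenSuc k β ∈ InT (suc n)
zerosThenSuc-InT zero    β∈T i       = s≤s (proj₁ (β∈T i)) , s<s (proj₂ (β∈T i))
zerosThenSuc-InT (suc k) β∈T zero    =
  let le , lt = zerosThenSuc-InT k β∈T 0 in z≤n , ≤-<-trans le lt
zerosThenSuc-InT (suc k) β∈T (suc i) = zerosThenSuc-InT k β∈T i

-- The tails are compared up to the same `N`, not `N - k`, so that the bound given by `ε` passes to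
-- the induction hypothesis without subtraction.
agree-zerosThenSuc : ∀ k {N α β} → AgreeBelow k α (const 0) →
  AgreeBelow N (λ i → α (i + k)) (suc ∘ β) → AgreeBelow N α (zerosThenSuc k β)
agree-zerosThenSuc zero    {α = α} _ rest i i<N =
  trans (cong α (sym (+-identityʳ i))) (rest i i<N)
agree-zerosThenSuc (suc k) zeros rest zero    _     = zeros 0 z<s
agree-zerosThenSuc (suc k) {suc N} {α} zeros rest (suc i) i<N =
  agree-zerosThenSuc k {N} (λ j j<k → zeros (suc j) (s<s j<k))
    (λ j j<N → trans (cong α (sym (+-suc j k))) (rest j (m<n⇒m<1+n j<N)))
    i (s<s⁻¹ i<N)

InT-tail : ∀ {n α} k → α ∈ InT n → (λ i → α (i + k)) ∈ InT n
InT-tail k α∈T i = α∈T (i + k)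

-- By monotonicity; hence 1 can be subtracted everywhere, which lowers the bound by one.
InT-nonZero : ∀ {n α} → α ∈ InT n → NonZero (α 0) → ∀ i → NonZero (α i)
InT-nonZero α∈T nz zero    = nz
InT-nonZero α∈T nz (suc i) =
  >-nonZero (<-≤-trans (>-nonZero⁻¹ _ ⦃ InT-nonZero α∈T nz i ⦄) (proj₁ (α∈T i)))

InT-pred : ∀ {n α} → α ∈ InT (suc n) → (∀ i → NonZero (α i)) → (pred ∘ α) ∈ InT n
InT-pred {n} {α} α∈T nz i =
  pred-mono-≤ (proj₁ (α∈T i)) ,
  s<s⁻¹ (subst (_< suc n) (sym (suc-pred (α (suc i)) ⦃ nz (suc i) ⦄)) (proj₂ (α∈T i)))

InT-1-zero : ∀ {α} → α ∈ InT 1 → ∀ i → α i ≡ 0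
InT-1-zero α∈T i = n<1⇒n≡0 (≤-<-trans (proj₁ (α∈T i)) (proj₂ (α∈T i)))

module _ (J : (ℕ × ℕ) ⤖ ℕ) where

  open Inverse (⤖⇒↔ J) renaming (to to pair; from to unpair; strictlyInverseʳ to unpair-pair)

  mutual
    -- The sequences `enum n j` enumerate `𝒯 (suc n)`, so the recursion starts at `𝒯 1`, whose only
    -- element is 0^ω.
    enum : ℕ → ℕ → 𝒩
    enum zero    _ = const 0
    enum (suc n) j = enumStep n (unpair j)

    -- Taking the decoded pair as an argument lets `enum-pair` rewrite along `unpair-pair` by a
    -- plain `cong`.
    enumStep : ℕ → ℕ × ℕ → 𝒩
    enumStep n (zero  , _) = const 0
    enumStep n (suc k , m) = zerosThenSuc k (enum n m)

  enum-InT : ∀ n j → enum n j ∈ InT (suc n)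
  enum-InT zero    _ _ = z≤n , z<s
  enum-InT (suc n) j with unpair j
  ... | zero  , _ = λ _ → z≤n , z<s
  ... | suc k , m = zerosThenSuc-InT k (enum-InT n m)

  enum-pair : ∀ n p i → enumStep n p i ≡ enum (suc n) (pair p) i
  enum-pair n p i = cong (λ q → enumStep n q i) (sym (unpair-pair p))

  -- Induction on `n` with `α` and `ε` both general, since the recursive call changes both.
  enum-complete : ∀ n α → α ∈ InT (suc n) → (ε : 𝒩) →
    ∃[ j ] AgreeBelow (ε j) α (enum n j)
  enum-complete zero    α α∈T ε = 0 , λ i _ → InT-1-zero α∈T i
  enum-complete (suc n) α α∈T ε with zeros-or-first-nonzero α (ε (pair (0 , 0)))
  ... | inj₁ zeros =
    pair (0 , 0) , λ i i<ε → trans (zeros i i<ε) (enum-pair n (0 , 0) i)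
  ... | inj₂ (k , zeros , nz) = index , λ i i<ε →
      trans (agree-zerosThenSuc k zeros tail-agrees i i<ε) (enum-pair n (suc k , m) i)
    where
    γ : 𝒩
    γ i = α (i + k)

    γ∈T : γ ∈ InT (suc (suc n))
    γ∈T = InT-tail {α = α} k α∈T

    γ-nonZero : ∀ i → NonZero (γ i)
    γ-nonZero = InT-nonZero {α = γ} γ∈T nz

    hyp : ∃[ m ] AgreeBelow (ε (pair (suc k , m))) (pred ∘ γ) (enum n m)
    -- An index `m` at level `n` will become `pair (suc k , m)` at level `suc n`. As `k` is already
    -- fixed, `ε` can be reindexed accordingly, and the agreement obtained reaches as far as `ε`
    -- demands at the final index.
    hyp = enum-complete n (pred ∘ γ) (InT-pred {α = γ} γ∈T γ-nonZero) (λ m → ε (pair (suc k , m)))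

    m index : ℕ
    m     = proj₁ hyp
    index = pair (suc k , m)

    tail-agrees : AgreeBelow (ε index) γ (suc ∘ enum n m)
    tail-agrees i i<ε =
      trans (sym (suc-pred (γ i) ⦃ γ-nonZero i ⦄)) (cong suc (proj₂ hyp i i<ε))

  interleave : (ℕ → 𝒩) → 𝒩
  interleave f j = let a , m = unpair j in f a m

  row-interleave : ∀ f a m → row J (interleave f) a m ≡ f a m
  row-interleave f a m = cong (λ p → f (proj₁ p) (proj₂ p)) (unpair-pair (a , m))

-- Rows of the interleaving equal the `enum` sequences only pointwise, so membership is transferred
-- without function extensionality.
InT-resp : ∀ {n α β} → (∀ i → α i ≡ β i) → α ∈ InT n → β ∈ InT n
InT-resp {n} eq α∈T i =
  subst₂ _≤_ (eq i) (eq (suc i)) (proj₁ (α∈T i)) , subst (_< n) (eq (suc i)) (proj₂ (α∈T i))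

theorem7p3 : (J : (ℕ × ℕ) ⤖ ℕ) → ∀ n → n > 0 → AlmostEnumerable J (𝒯 n)
theorem7p3 J (suc n) _ = inj₂ (interleave J (enum J n) , rows-InT , complete)
  where
  row≡enum : ∀ a m → row J (interleave J (enum J n)) a m ≡ enum J n a m
  row≡enum = row-interleave J (enum J n)

  rows-InT : ∀ a → row J (interleave J (enum J n)) a ∈ InT (suc n)
  rows-InT a = InT-resp (λ m → sym (row≡enum a m)) (enum-InT J n a)

  complete : ∀ α → α ∈ InT (suc n) → (ε : 𝒩) →
    ∃[ a ] α ↾ ε a ≡ row J (interleave J (enum J n)) a ↾ ε a
  complete α α∈T ε =
    let a , agree = enum-complete J n α α∈T ε in
    a , ↾-cong (ε a) (λ i i<ε → trans (agree i i<ε) (sym (row≡enum a i)))
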